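{- For any finite simple undirected graph $G$ with at least one edge, the regular number of $G$ satisfies $r(G) \le \Delta + 1$, where $\Delta$ denotes the maximum degree of a vertex in $G$.
   Context: For a set $F$ of edges of a graph $G$, the subgraph induced by $F$, denoted $\langle F \rangle$, is the graph whose edge set is $F$ and whose vertex set is the set of endpoints of edges in $F$ (it need not contain all the vertices of $G$). The regular number $r(G)$ of a graph $G=(V,E)$ is the minimum number of nonempty subsets into which the edge set $E$ can be partitioned so that the subgraph induced by each subset is regular (i.e. all of its vertices have the same degree; different subsets may have different degrees of regularity, and the induced subgraphs need not be connected). -}

module Defs where

open import Data.Bool using (Bool; true; false; T; T?)
import Data.Bool.Properties as Bool
open import Data.Empty using (⊥-elim)
open import Data.Fin using (Fin; zero; suc; _<_; _≟_; _<?_)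
open import Data.Fin.Properties using (any?; all?; <-cmp; <-irrefl)
open import Data.Fin.Subset using (Subset; _∈_; ∣_∣; ⁅_⁆)
open import Data.Fin.Subset.Properties using (_∈?_; nonempty?; ⊆-antisym; x∈⁅x⁆; x∈⁅y⁆⇒x≡y; ∣⁅x⁆∣≡1)
open import Data.List using (List; map; filter; allFin; length; cartesianProduct; lookup)
open import Data.List.Extrema.Nat using (max)
import Data.List.Membership.Propositional as List
open import Data.List.Membership.Propositional.Properties using (∈-lookup; ∈-filter⁺; ∈-filter⁻; ∈-allFin; ∈-cartesianProduct⁺)
import Data.List.Relation.Unary.All as All
import Data.List.Relation.Unary.AllPairs as AllPairs
import Data.List.Relation.Unary.Any as Any
open import Data.List.Relation.Unary.Any.Properties using (lookup-index)
open import Data.List.Relation.Unary.Unique.Propositional using (Unique)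
import Data.List.Relation.Unary.Unique.Propositional.Properties as Unique
open import Data.Nat using (ℕ; zero; suc; _≤_; z≤n; s≤s)
import Data.Nat.Properties as ℕ
open import Data.Product using (∃; ∃-syntax; ∃₂; _×_; _,_; proj₁; proj₂; uncurry)
open import Data.Sum using (_⊎_; inj₁; inj₂)
open import Data.Vec using (tabulate)
open import Data.Vec.Functional using () renaming ([] to []ᶠ; _∷_ to _∷ᶠ_)
open import Data.Vec.Properties using (lookup∘tabulate; tabulate-cong; []=⇒lookup; lookup⇒[]=)
open import Function using (_∘_; _⇔_; mk⇔; Equivalence)
open import Relation.Binary using (tri<; tri≈; tri>)
open import Relation.Binary.PropositionalEquality using (_≡_; refl; sym; trans; cong; cong₂; subst; subst₂)
open import Relation.Nullary using (Dec; yes; no; does)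
open import Relation.Nullary.Decidable using (map′; _×-dec_; _→-dec_; _⊎-dec_; does-⇔; dec-false)
open import Relation.Unary using (Decidable)

-- A set of two-element subsets {u , v} of Fin n, given by its characteristic
-- function on ordered pairs.
record EdgeSet (n : ℕ) : Set where
  field
    member      : Fin n → Fin n → Bool
    symmetric   : ∀ u v → member u v ≡ member v u
    irreflexive : ∀ v → member v v ≡ false

open EdgeSet public

Joins : ∀ {n} → EdgeSet n → Fin n → Fin n → Set
Joins F u v = T (member F u v)

HasEdge : ∀ {n} → EdgeSet n → Set
HasEdge F = ∃₂ λ u v → Joins F u v

neighbours : ∀ {n} → EdgeSet n → Fin n → Subset n
neighbours F v = tabulate (member F v)

endpoints : ∀ {n} → EdgeSet n → Subset n
endpoints F = tabulate λ v → does (nonempty? (neighbours F v))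

-- A finite simple undirected graph.  The vertex set is a subset of Fin n, so
-- that a graph and its edge-induced subgraphs live in the same type.
record Graph (n : ℕ) : Set where
  field
    vertices : Subset n
    edges    : EdgeSet n
    incident : ∀ {u v} → Joins edges u v → u ∈ vertices

open Graph public

degree : ∀ {n} → Graph n → Fin n → ℕ
degree G v = ∣ neighbours (edges G) v ∣

-- The base value 0 of the maximum only matters when there are no vertices.
maxDegree : ∀ {n} → Graph n → ℕ
maxDegree {n} G = max 0 (map (degree G) (filter (_∈? vertices G) (allFin n)))

Regular : ∀ {n} → Graph n → Set
Regular G = ∃[ d ] ∀ v → v ∈ vertices G → degree G v ≡ d

T-does : ∀ {A : Set} (a? : Dec A) → T (does a?) ⇔ A
T-does (yes a) = mk⇔ (λ _ → a) _
T-does (no ¬a) = mk⇔ (λ ()) ¬a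

∈-tabulate : ∀ {n} (f : Fin n → Bool) v → v ∈ tabulate f ⇔ T (f v)
∈-tabulate f v = mk⇔
  (λ v∈ → Equivalence.from Bool.T-≡ (trans (sym (lookup∘tabulate f v)) ([]=⇒lookup v∈)))
  (λ t → lookup⇒[]= v _ (trans (lookup∘tabulate f v) (Equivalence.to Bool.T-≡ t)))

∈-neighbours : ∀ {n} (F : EdgeSet n) u v → v ∈ neighbours F u ⇔ Joins F u v
∈-neighbours F u v = ∈-tabulate (member F u) v

∈-endpoints : ∀ {n} (F : EdgeSet n) u → u ∈ endpoints F ⇔ (∃[ v ] Joins F u v)
∈-endpoints F u = mk⇔
  (λ u∈ → let v , v∈ = Equivalence.to (T-does (nonempty? _)) (Equivalence.to (∈-tabulate _ u) u∈)
          in v , Equivalence.to (∈-neighbours F u v) v∈)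
  (λ (v , uv) → Equivalence.from (∈-tabulate _ u)
    (Equivalence.from (T-does (nonempty? _)) (v , Equivalence.from (∈-neighbours F u v) uv)))

⟨_⟩ : ∀ {n} → EdgeSet n → Graph n
⟨ F ⟩ = record
  { vertices = endpoints F
  ; edges    = F
  ; incident = λ {u} {v} uv → Equivalence.from (∈-endpoints F u) (v , uv)
  }

-- Disjoint nonempty parts are automatically distinct, so an indexed family
-- satisfying this has exactly k different members.
record IsPartition {n k} (E : EdgeSet n) (parts : Fin k → EdgeSet n) : Set where
  field
    nonempty : ∀ i → HasEdge (parts i)
    sub      : ∀ i u v → Joins (parts i) u v → Joins E u v
    cover    : ∀ u v → Joins E u v → ∃[ i ] Joins (parts i) u v
    disjoint : ∀ i j u v → Joins (parts i) u v → Joins (parts j) u v → i ≡ j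

IsRegularPartition : ∀ {n k} → Graph n → (Fin k → EdgeSet n) → Set
IsRegularPartition G parts = IsPartition (edges G) parts × (∀ i → Regular ⟨ parts i ⟩)

HasRegularPartition : ∀ {n} → Graph n → ℕ → Set
HasRegularPartition {n} G k = ∃[ parts ] IsRegularPartition {n} {k} G parts

IsMinimum : (ℕ → Set) → ℕ → Set
IsMinimum P m = P m × (∀ k → P k → m ≤ k)

minimum : ∀ {P : ℕ → Set} → Decidable P → ∀ k → P k → ∃ (IsMinimum P)
minimum P? zero pk = zero , pk , λ _ _ → z≤n
minimum {P} P? (suc k) pk with P? zero
... | yes p0 = zero , p0 , λ _ _ → z≤n
... | no ¬p0 with minimum {P ∘ suc} (P? ∘ suc) k pk
...   | m , pm , m≤ = suc m , pm , λ where
          zero    p0 → ⊥-elim (¬p0 p0)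
          (suc j) pj → s≤s (m≤ j pj)

regular? : ∀ {n} (G : Graph n) → Dec (Regular G)
regular? G with nonempty? (vertices G)
... | no  ¬v       = yes (0 , λ v v∈ → ⊥-elim (¬v (v , v∈)))
... | yes (w , w∈) = map′ (degree G w ,_) (λ (d , eq) v v∈ → trans (eq v v∈) (sym (eq w w∈)))
  (all? λ v → (v ∈? vertices G) →-dec (degree G v ℕ.≟ degree G w))

isPartition? : ∀ {n k} (E : EdgeSet n) (parts : Fin k → EdgeSet n) → Dec (IsPartition E parts)
isPartition? E parts = map′
  (λ (a , b , c , d) → record { nonempty = a ; sub = b ; cover = c ; disjoint = d })
  (λ p → let open IsPartition p in nonempty , sub , cover , disjoint)
  (      (all? λ i → any? λ u → any? λ v → T? (member (parts i) u v))
   ×-dec (all? λ i → all? λ u → all? λ v → T? (member (parts i) u v) →-dec T? (member E u v))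
   ×-dec (all? λ u → all? λ v → T? (member E u v) →-dec any? λ i → T? (member (parts i) u v))
   ×-dec (all? λ i → all? λ j → all? λ u → all? λ v →
            T? (member (parts i) u v) →-dec (T? (member (parts j) u v) →-dec (i ≟ j))))

isRegularPartition? : ∀ {n k} (G : Graph n) (parts : Fin k → EdgeSet n) → Dec (IsRegularPartition G parts)
isRegularPartition? G parts = isPartition? (edges G) parts ×-dec all? λ i → regular? ⟨ parts i ⟩

_≐_ : ∀ {n} → EdgeSet n → EdgeSet n → Set
F ≐ F′ = ∀ u v → member F u v ≡ member F′ u v

regular-resp : ∀ {n} {F F′ : EdgeSet n} → F ≐ F′ → Regular ⟨ F ⟩ → Regular ⟨ F′ ⟩
regular-resp {F = F} {F′} eq (d , reg) = d , λ u u∈ →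
  let v , uv = Equivalence.to (∈-endpoints F′ u) u∈
  in trans (cong ∣_∣ (sym (tabulate-cong (eq u))))
       (reg u (Equivalence.from (∈-endpoints F u) (v , subst T (sym (eq u v)) uv)))

isRegularPartition-resp : ∀ {n k} (G : Graph n) {parts parts′ : Fin k → EdgeSet n} →
  (∀ i → parts i ≐ parts′ i) → IsRegularPartition G parts → IsRegularPartition G parts′
isRegularPartition-resp G {parts} {parts′} eq (p , reg) = record
  { nonempty = λ i → let u , v , uv = nonempty i in u , v , to i u v uv
  ; sub      = λ i u v → sub i u v ∘ from i u v
  ; cover    = λ u v uv → let i , uv∈i = cover u v uv in i , to i u v uv∈i
  ; disjoint = λ i j u v uv∈i uv∈j → disjoint i j u v (from i u v uv∈i) (from j u v uv∈j)
  } , λ i → regular-resp {F = parts i} {parts′ i} (eq i) (reg i)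
  where
  open IsPartition p
  to = λ i u v → subst T (eq i u v)
  from = λ i u v → subst T (sym (eq i u v))

-- There is no function extensionality, so exhaustive search through functions
-- out of Fin n is restricted to predicates respecting pointwise equality.
Searchable : (A : Set) → (A → A → Set) → Set₁
Searchable A _≈_ = (P : A → Set) → (∀ {x y} → x ≈ y → P x → P y) → Decidable P → Dec (∃ P)

search-Bool : Searchable Bool _≡_
search-Bool P _ P? = map′
  (λ { (inj₁ p) → true , p ; (inj₂ p) → false , p })
  (λ { (true , p) → inj₁ p ; (false , p) → inj₂ p })
  (P? true ⊎-dec P? false)

search-→ : ∀ {A : Set} {_≈_ : A → A → Set} → (∀ {x} → x ≈ x) → Searchable A _≈_ →
  ∀ n → Searchable (Fin n → A) (λ f g → ∀ i → f i ≈ g i)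
search-→ ≈-refl search zero P resp P? =
  map′ ([]ᶠ ,_) (λ (f , p) → resp (λ ()) p) (P? []ᶠ)
search-→ ≈-refl search (suc n) P resp P? = map′
  (λ (a , f , p) → a ∷ᶠ f , p)
  (λ (f , p) → f zero , f ∘ suc , resp (λ { zero → ≈-refl ; (suc i) → ≈-refl }) p)
  (search (λ a → ∃ λ f → P (a ∷ᶠ f))
    (λ a≈b (f , p) → f , resp (λ { zero → a≈b ; (suc i) → ≈-refl }) p)
    (λ a → search-→ ≈-refl search n (λ f → P (a ∷ᶠ f))
      (λ f≈g → resp λ { zero → ≈-refl ; (suc i) → f≈g i }) (λ f → P? (a ∷ᶠ f))))

hasRegularPartition? : ∀ {n} (G : Graph n) → Decidable (HasRegularPartition G)
hasRegularPartition? {n} G k = map′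
  (λ (X , ok , p) → edgeSets X ok , p)
  (λ (parts , p) → member ∘ parts
    , ((λ i → symmetric (parts i)) , (λ i → irreflexive (parts i)))
    , isRegularPartition-resp G (λ _ _ _ → refl) p)
  (search-→ (λ _ _ → refl) (search-→ (λ _ → refl) (search-→ refl search-Bool n) n) k
    Valid valid-resp valid?)
  where
  Family = Fin k → Fin n → Fin n → Bool

  IsFamily : Family → Set
  IsFamily X = (∀ i u v → X i u v ≡ X i v u) × (∀ i v → X i v v ≡ false)

  edgeSets : (X : Family) → IsFamily X → Fin k → EdgeSet n
  edgeSets X (s , r) i = record { member = X i ; symmetric = s i ; irreflexive = r i }

  Valid : Family → Set
  Valid X = ∃ λ (ok : IsFamily X) → IsRegularPartition G (edgeSets X ok)

  valid-resp : ∀ {X Y} → (∀ i u v → X i u v ≡ Y i u v) → Valid X → Valid Y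
  valid-resp eq ((s , r) , p) =
    ( (λ i u v → trans (sym (eq i u v)) (trans (s i u v) (eq i v u)))
    , (λ i v → trans (sym (eq i v v)) (r i v)))
    , isRegularPartition-resp G eq p

  valid? : Decidable Valid
  valid? X with (all? λ i → all? λ u → all? λ v → X i u v Bool.≟ X i v u)
                ×-dec (all? λ i → all? λ v → X i v v Bool.≟ false)
  ... | no ¬ok = no (¬ok ∘ proj₁)
  ... | yes ok = map′ (ok ,_) (λ (_ , p) → isRegularPartition-resp G (λ _ _ _ → refl) p)
                   (isRegularPartition? G (edgeSets X ok))

lookup-injective : ∀ {A : Set} {xs : List A} → Unique xs → ∀ i j → lookup xs i ≡ lookup xs j → i ≡ j
lookup-injective (_ AllPairs.∷ _)   zero    zero    _  = refl
lookup-injective (x∉ AllPairs.∷ _)  zero    (suc j) eq = ⊥-elim (All.lookup x∉ (∈-lookup j) eq)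
lookup-injective (x∉ AllPairs.∷ _)  (suc i) zero    eq = ⊥-elim (All.lookup x∉ (∈-lookup i) (sym eq))
lookup-injective (_ AllPairs.∷ xs!) (suc i) (suc j) eq = cong suc (lookup-injective xs! i j eq)

singletonEdge : ∀ {n} (a b : Fin n) → a < b → EdgeSet n
singletonEdge a b a<b = record
  { member      = λ u v → does (same? u v)
  ; symmetric   = λ u v → does-⇔ (mk⇔ (swap u v) (swap v u)) (same? u v) (same? v u)
  ; irreflexive = λ v → dec-false (same? v v)
      λ { (inj₁ (refl , refl)) → <-irrefl refl a<b ; (inj₂ (refl , refl)) → <-irrefl refl a<b }
  }
  where
  Same : Fin _ → Fin _ → Set
  Same u v = (u ≡ a × v ≡ b) ⊎ (v ≡ a × u ≡ b)

  same? : ∀ u v → Dec (Same u v)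
  same? u v = ((u ≟ a) ×-dec (v ≟ b)) ⊎-dec ((v ≟ a) ×-dec (u ≟ b))

  swap : ∀ u v → Same u v → Same v u
  swap _ _ (inj₁ p) = inj₂ p
  swap _ _ (inj₂ p) = inj₁ p

joins-singletonEdge : ∀ {n} {a b : Fin n} (a<b : a < b) u v →
  Joins (singletonEdge a b a<b) u v ⇔ ((u ≡ a × v ≡ b) ⊎ (v ≡ a × u ≡ b))
joins-singletonEdge {a = a} {b} a<b u v =
  T-does (((u ≟ a) ×-dec (v ≟ b)) ⊎-dec ((v ≟ a) ×-dec (u ≟ b)))

singletonEdge-regular : ∀ {n} {a b : Fin n} (a<b : a < b) → Regular ⟨ singletonEdge a b a<b ⟩
singletonEdge-regular {n} {a} {b} a<b = 1 , λ u u∈ →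
  one u (Equivalence.to (∈-endpoints F u) u∈)
  where
  F = singletonEdge a b a<b

  unique : ∀ {u v w} → Joins F u v → Joins F u w → w ≡ v
  unique {u} {v} {w} uv uw with Equivalence.to (joins-singletonEdge a<b u v) uv
                              | Equivalence.to (joins-singletonEdge a<b u w) uw
  ... | inj₁ (_ , refl)    | inj₁ (_ , refl)    = refl
  ... | inj₁ (refl , refl) | inj₂ (_ , refl)    = ⊥-elim (<-irrefl refl a<b)
  ... | inj₂ (_ , refl)    | inj₁ (refl , refl) = ⊥-elim (<-irrefl refl a<b)
  ... | inj₂ (refl , _)    | inj₂ (refl , _)    = refl

  one : ∀ u → ∃[ v ] Joins F u v → ∣ neighbours F u ∣ ≡ 1
  one u (v , uv) = trans (cong ∣_∣ (⊆-antisym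
      (λ {w} w∈ → subst (_∈ ⁅ v ⁆) (sym (unique {u} uv (Equivalence.to (∈-neighbours F u w) w∈))) (x∈⁅x⁆ v))
      (λ {w} w∈ → subst (_∈ neighbours F u) (sym (x∈⁅y⁆⇒x≡y v w∈)) (Equivalence.from (∈-neighbours F u v) uv))))
    (∣⁅x⁆∣≡1 v)

singletonPartition : ∀ {n} (G : Graph n) → ∃ (HasRegularPartition G)
singletonPartition {n} G = length es , parts , partition , λ i → singletonEdge-regular (ordered i)
  where
  IsEdge : Fin n × Fin n → Set
  IsEdge (u , v) = u < v × Joins (edges G) u v

  isEdge? : Decidable IsEdge
  isEdge? (u , v) = (u <? v) ×-dec T? (member (edges G) u v)

  all-pairs = cartesianProduct (allFin n) (allFin n)
  es = filter isEdge? all-pairs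

  es! : Unique es
  es! = Unique.filter⁺ isEdge? (Unique.cartesianProduct⁺ (Unique.allFin⁺ n) (Unique.allFin⁺ n))

  isEdge : ∀ i → IsEdge (lookup es i)
  isEdge i = proj₂ (∈-filter⁻ isEdge? {xs = all-pairs} (∈-lookup i))

  fst snd : Fin (length es) → Fin n
  fst i = proj₁ (lookup es i)
  snd i = proj₂ (lookup es i)

  ordered : ∀ i → fst i < snd i
  ordered i = proj₁ (isEdge i)

  parts : Fin (length es) → EdgeSet n
  parts i = singletonEdge (fst i) (snd i) (ordered i)

  joins-swap : ∀ {u v} → Joins (edges G) u v → Joins (edges G) v u
  joins-swap {u} {v} = subst T (symmetric (edges G) u v)

  to : ∀ i u v → Joins (parts i) u v → (u ≡ fst i × v ≡ snd i) ⊎ (v ≡ fst i × u ≡ snd i)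
  to i u v = Equivalence.to (joins-singletonEdge (ordered i) u v)

  from : ∀ i u v → (u ≡ fst i × v ≡ snd i) ⊎ (v ≡ fst i × u ≡ snd i) → Joins (parts i) u v
  from i u v = Equivalence.from (joins-singletonEdge (ordered i) u v)

  find : ∀ u v → u < v → Joins (edges G) u v → ∃[ i ] (u ≡ fst i × v ≡ snd i)
  find u v u<v uv = Any.index e∈ , cong proj₁ (lookup-index e∈) , cong proj₂ (lookup-index e∈)
    where
    e∈ : (u , v) List.∈ es
    e∈ = ∈-filter⁺ isEdge? (∈-cartesianProduct⁺ (∈-allFin u) (∈-allFin v)) (u<v , uv)

  sub : ∀ i u v → Joins (parts i) u v → Joins (edges G) u v
  sub i u v uv with to i u v uv
  ... | inj₁ (refl , refl) = proj₂ (isEdge i)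
  ... | inj₂ (refl , refl) = joins-swap (proj₂ (isEdge i))

  cover : ∀ u v → Joins (edges G) u v → ∃[ i ] Joins (parts i) u v
  cover u v uv with <-cmp u v
  ... | tri< u<v _ _  = let i , eq = find u v u<v uv in i , from i u v (inj₁ eq)
  ... | tri> _ _ v<u  = let i , eq = find v u v<u (joins-swap uv) in i , from i u v (inj₂ eq)
  ... | tri≈ _ refl _ = ⊥-elim (subst T (irreflexive (edges G) u) uv)

  disjoint : ∀ i j u v → Joins (parts i) u v → Joins (parts j) u v → i ≡ j
  disjoint i j u v uv∈i uv∈j with to i u v uv∈i | to j u v uv∈j
  ... | inj₁ (a , b) | inj₁ (c , d) = lookup-injective es! i j (cong₂ _,_ (trans (sym a) c) (trans (sym b) d))
  ... | inj₂ (a , b) | inj₂ (c , d) = lookup-injective es! i j (cong₂ _,_ (trans (sym a) c) (trans (sym b) d))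
  ... | inj₁ (a , b) | inj₂ (c , d) = ⊥-elim (ℕ.<-asym (subst₂ _<_ (sym a) (sym b) (ordered i)) (subst₂ _<_ (sym c) (sym d) (ordered j)))
  ... | inj₂ (a , b) | inj₁ (c , d) = ⊥-elim (ℕ.<-asym (subst₂ _<_ (sym a) (sym b) (ordered i)) (subst₂ _<_ (sym c) (sym d) (ordered j)))

  partition : IsPartition (edges G) parts
  partition = record
    { nonempty = λ i → fst i , snd i , from i (fst i) (snd i) (inj₁ (refl , refl))
    ; sub = sub ; cover = cover ; disjoint = disjoint }

leastRegularPartition : ∀ {n} (G : Graph n) → ∃ (IsMinimum (HasRegularPartition G))
leastRegularPartition G = uncurry (minimum (hasRegularPartition? G)) (singletonPartition G)

regularNumber : ∀ {n} → Graph n → ℕ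
regularNumber G = proj₁ (leastRegularPartition G)

regularNumber-isMinimum : ∀ {n} (G : Graph n) → IsMinimum (HasRegularPartition G) (regularNumber G)
regularNumber-isMinimum G = proj₂ (leastRegularPartition G)

{-# OPTIONS --safe #-}

-- A matching induces a 1-regular graph, so it suffices to colour the edges
-- properly with Δ + 1 colours (Vizing's theorem) and keep the nonempty colour
-- classes.  Edges are coloured one at a time.  Given an uncoloured edge xy,
-- follow the fan y = y₀, y₁, … of neighbours of x in which xyᵢ₊₁ has a colour
-- missing at yᵢ, until a missing colour of the last vertex is missing at x or
-- the fan would revisit a vertex; in the second case exchanging two colours
-- along the Kempe chain of x leads back to the first one.

module Submission where

open import Defs
open import Data.Bool using (true; false; T; if_then_else_)
open import Data.Bool.Properties using (T?)
open import Data.Empty using (⊥-elim)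
open import Data.Fin using (Fin; zero; suc; toℕ; fromℕ<; _≟_)
open import Data.Fin.Permutation.Components using (transpose; transpose-inverse)
open import Data.Fin.Properties using (any?; all?; pigeonhole; toℕ<n; toℕ-fromℕ<; suc-injective)
open import Data.Fin.Subset using (Subset; _∈_; ∣_∣; ⁅_⁆; _-_)
open import Data.Fin.Subset.Properties using (_∈?_; ⊆-antisym; x∈⁅x⁆; x∈⁅y⁆⇒x≡y; ∣⁅x⁆∣≡1; x∈p∧x≢y⇒x∈p-y; x∈p⇒∣p-x∣<∣p∣)
open import Data.List using (List; []; _∷_; map; filter; allFin; length; cartesianProduct; lookup)
open import Data.List.Extrema.Nat using (xs≤max)
import Data.List.Membership.Propositional as List
open import Data.List.Membership.Propositional.Properties using (∈-lookup; ∈-map⁺; ∈-filter⁺; ∈-filter⁻; ∈-allFin; ∈-cartesianProduct⁺)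
open import Data.List.Properties using (length-filter; length-tabulate)
import Data.List.Relation.Unary.All as All
open import Data.List.Relation.Unary.Any using (here; there; index)
open import Data.List.Relation.Unary.Any.Properties using (lookup-index)
import Data.List.Relation.Unary.Unique.Propositional.Properties as Unique
open import Data.Maybe using (Maybe; just; nothing)
import Data.Maybe as Maybe
open import Data.Maybe.Properties using (just-injective; ≡-dec; map-injective)
open import Data.Nat using (ℕ; zero; suc; _+_; _∸_; _≤_; _<_; z≤n; s≤s; ⌊_/2⌋)
open import Data.Nat.GeneralisedArithmetic using (fold)
import Data.Nat.Properties as ℕ
open import Data.Product using (∃; ∃-syntax; _×_; _,_; proj₁; proj₂)
open import Data.Sum using (_⊎_; inj₁; inj₂)
open import Function using (_∘_; id; case_of_; Equivalence)
open import Relation.Binary using (tri<; tri≈; tri>)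
open import Relation.Binary.PropositionalEquality using (_≡_; _≢_; refl; sym; trans; cong; subst)
open import Relation.Nullary using (¬_; Dec; yes; no; does)
open import Relation.Nullary.Decidable using (_×-dec_; _⊎-dec_; ¬?; dec-true; dec-false)
open import Relation.Unary using (Decidable)

-- Orbits of two involutions

-- The component of x in the union of two matchings, given as involutions whose
-- fixed points are the unmatched vertices.
record AlternatingPath {n} (f g : Fin n → Fin n) (x : Fin n) : Set₁ where
  field
    Inside   : Fin n → Set
    inside?  : Decidable Inside
    start    : Inside x
    closed-f : ∀ {v} → Inside v → Inside (f v)
    closed-g : ∀ {v} → Inside v → Inside (g v)
    end-unique : ∀ {v w} → Inside v → Inside w → g v ≡ v → g w ≡ w → v ≡ w

module _ {n} {f g : Fin n → Fin n} (f-involutive : ∀ v → f (f v) ≡ v)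
         (g-involutive : ∀ v → g (g v) ≡ v) {x : Fin n} (fx≡x : f x ≡ x) where

  private
    -- Because `f` fixes `x`, walking from `x` in one direction reaches the whole component: `f` and
    -- `g` map this orbit of `f ∘ g` to itself.
    p : ℕ → Fin n
    p = fold x (f ∘ g)

    fg-injective : ∀ {v w} → f (g v) ≡ f (g w) → v ≡ w
    fg-injective {v} {w} eq = trans (sym (g-involutive v)) (trans (cong g
      (trans (sym (f-involutive _)) (trans (cong f eq) (f-involutive _)))) (g-involutive w))

    -- As `f ∘ g` is injective, a collision pulls back to the start: the orbit is a cycle without a
    -- tail.
    cancel : ∀ i d → p i ≡ p (i + d) → p d ≡ x
    cancel zero    d eq = sym eq
    cancel (suc i) d eq = cancel i d (fg-injective eq)

    returns : ∃ λ i → p (suc i) ≡ x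
    returns with pigeonhole (ℕ.n<1+n n) (p ∘ toℕ)
    ... | i , j , i<j , eq with ℕ.m≤n⇒∃[o]m+o≡n i<j
    ...   | d , i+d≡j = d , cancel (toℕ i) (suc d)
      (trans eq (cong p (trans (sym i+d≡j) (sym (ℕ.+-suc (toℕ i) d)))))

    abstract
      least : ∃ (IsMinimum λ i → p (suc i) ≡ x)
      least = minimum (λ i → p (suc i) ≟ x) (proj₁ returns) (proj₂ returns)

    r : ℕ
    r = suc (proj₁ least)

    no-return : ∀ d → suc d < r → p (suc d) ≢ x
    no-return d d<r eq = ℕ.<⇒≱ (ℕ.≤-pred d<r) (proj₂ (proj₂ least) d eq)

    p-≢ : ∀ {i j} → i < j → j < r → p i ≢ p j
    p-≢ {i} i<j j<r eq with ℕ.m≤n⇒∃[o]m+o≡n i<j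
    ... | d , refl = no-return d (ℕ.≤-<-trans (s≤s (ℕ.m≤n+m d i)) j<r)
      (cancel i (suc d) (trans eq (cong p (sym (ℕ.+-suc i d)))))

    p-injective : ∀ {i j} → i < r → j < r → p i ≡ p j → i ≡ j
    p-injective {i} {j} i<r j<r eq with ℕ.<-cmp i j
    ... | tri< i<j _ _ = ⊥-elim (p-≢ i<j j<r eq)
    ... | tri≈ _ i≡j _ = i≡j
    ... | tri> _ _ j<i = ⊥-elim (p-≢ j<i i<r (sym eq))

    -- f and g act as reflections on the orbit of x under f ∘ g, indexed by ℤ/r.
    reflect-f : ∀ i j → i + j ≡ r → f (p i) ≡ p j
    reflect-g : ∀ i j → suc i + j ≡ r → g (p i) ≡ p j

    -- At index 0 the partner `j` is the period `r` itself, and `p r` is `x`.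
    reflect-f zero    j refl = trans fx≡x (sym (proj₁ (proj₂ least)))
    reflect-f (suc i) j eq   = trans (f-involutive _) (reflect-g i j eq)

    -- Applying `f` to `f (p i) ≡ p (suc j)`, where `p (suc j)` is `f (g (p j))`, gives
    -- `p i ≡ g (p j)`.
    reflect-g i j eq = trans (cong g
      (trans (sym (f-involutive _)) (trans (cong f (reflect-f i (suc j) (trans (ℕ.+-suc i j) eq)))
      (f-involutive _)))) (g-involutive _)

    Inside : Fin n → Set
    Inside v = ∃ λ (i : Fin r) → p (toℕ i) ≡ v

    inside : ∀ {i} → i < r → Inside (p i)
    inside i<r = fromℕ< i<r , cong p (toℕ-fromℕ< i<r)

    inside-f : ∀ i → i < r → Inside (f (p i))
    -- The reflection of 0 is `r`, just outside `Fin r`, so this case falls back on `f` fixing `x`.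
    inside-f zero    _   = zero , sym fx≡x
    inside-f (suc i) i<r = subst Inside
      (sym (reflect-f (suc i) (r ∸ suc i) (ℕ.m+[n∸m]≡n (ℕ.<⇒≤ i<r)))) (inside (s≤s (ℕ.m∸n≤m _ i)))

    inside-g : ∀ i → i < r → Inside (g (p i))
    inside-g i i<r = subst Inside
      (sym (reflect-g i (r ∸ suc i) (ℕ.m+[n∸m]≡n i<r))) (inside (s≤s (ℕ.m∸n≤m _ i)))

    -- The reflection i ↦ r - 1 - i has at most one fixed point.
    middle : ∀ i → i < r → g (p i) ≡ p i → i ≡ ⌊ r /2⌋
    -- From `i ≡ r ∸ suc i` the period is odd, `r = 1 + (i + i)`, and half of it rounded down is
    -- `i`.
    middle i i<r eq = trans (ℕ.n≡⌈n+n/2⌉ i) (cong (⌊_/2⌋ ∘ suc)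
      (trans (cong (i +_) i≡) (ℕ.suc-injective (ℕ.m+[n∸m]≡n i<r))))
      where
      i≡ : i ≡ r ∸ suc i
      i≡ = p-injective i<r (s≤s (ℕ.m∸n≤m _ i))
        (trans (sym eq) (reflect-g i (r ∸ suc i) (ℕ.m+[n∸m]≡n i<r)))

  abstract
    alternatingPath : AlternatingPath f g x
    alternatingPath = record
      { Inside     = Inside
      ; inside?    = λ v → any? λ i → p (toℕ i) ≟ v
      ; start      = zero , refl
      ; closed-f   = λ { (i , refl) → inside-f (toℕ i) (toℕ<n i) }
      ; closed-g   = λ { (i , refl) → inside-g (toℕ i) (toℕ<n i) }
      ; end-unique = λ { (i , refl) (j , refl) eq₁ eq₂ →
          cong p (trans (middle (toℕ i) (toℕ<n i) eq₁) (sym (middle (toℕ j) (toℕ<n j) eq₂))) }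
      }

-- Transpositions of colours

transpose-injective : ∀ {n} (i j : Fin n) {k l} → transpose i j k ≡ transpose i j l → k ≡ l
transpose-injective i j eq =
  trans (sym (transpose-inverse j i)) (trans (cong (transpose j i) eq) (transpose-inverse j i))

transpose-left : ∀ {n} (i j : Fin n) → transpose i j i ≡ j
transpose-left i j rewrite dec-true (i ≟ i) refl = refl

transpose-fixes : ∀ {n} {i j k : Fin n} → k ≢ i → k ≢ j → transpose i j k ≡ k
transpose-fixes {i = i} {j} {k} k≢i k≢j
  rewrite dec-false (k ≟ i) k≢i | dec-false (k ≟ j) k≢j = refl

-- Partial edge colourings

module _ {n k : ℕ} where

  Colouring : Set
  Colouring = Fin n → Fin n → Maybe (Fin k)

  record IsColouring (E : EdgeSet n) (c : Colouring) : Set where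
    field
      sub    : ∀ {u v a} → c u v ≡ just a → Joins E u v
      comm   : ∀ u v → c u v ≡ c v u
      proper : ∀ {u v w a} → c u v ≡ just a → c u w ≡ just a → v ≡ w

  Coloured : Colouring → Fin n → Fin n → Set
  Coloured c u v = ∃[ a ] c u v ≡ just a

  Missing : Colouring → Fin n → Fin k → Set
  Missing c v a = ∀ w → c v w ≢ just a

  -- Compares only which edges are coloured: rotations and chain exchanges change the colours
  -- themselves.
  _⊑_ : Colouring → Colouring → Set
  c ⊑ c′ = ∀ {u v} → Coloured c u v → Coloured c′ u v

  Completion : EdgeSet n → Colouring → Fin n → Fin n → Set
  Completion E c x y = ∃[ c′ ] IsColouring E c′ × c ⊑ c′ × Coloured c′ x y

  hasColour? : (c : Colouring) (v : Fin n) (a : Fin k) (w : Fin n) → Dec (c v w ≡ just a)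
  hasColour? c v a w = ≡-dec _≟_ (c v w) (just a)

  missing? : ∀ c v → Decidable (Missing c v)
  missing? c v a = all? λ w → ¬? (hasColour? c v a w)

  distinct-ends : ∀ {E : EdgeSet n} {x y} → Joins E x y → x ≢ y
  distinct-ends {E} xy refl = subst T (irreflexive E _) xy

  joins-sym : ∀ {E : EdgeSet n} {x y} → Joins E x y → Joins E y x
  joins-sym {E} {x} {y} = subst T (symmetric E x y)

  -- The default v makes a vertex missing the colour a fixed point.
  neighbour : Colouring → Fin k → Fin n → Fin n
  neighbour c a v with any? (hasColour? c v a)
  ... | yes (w , _) = w
  ... | no  _       = v

  module _ {E : EdgeSet n} {c : Colouring} (ok : IsColouring E c) where
    open IsColouring ok

    neighbour-unique : ∀ {a v w} → c v w ≡ just a → neighbour c a v ≡ w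
    neighbour-unique {a} {v} vw with any? (hasColour? c v a)
    ... | yes (_ , vw′) = proper vw′ vw
    ... | no  none      = ⊥-elim (none (_ , vw))

    neighbour-coloured : ∀ {a v} → ¬ Missing c v a → c v (neighbour c a v) ≡ just a
    neighbour-coloured {a} {v} present with any? (hasColour? c v a)
    ... | yes (_ , vw) = vw
    ... | no  none     = ⊥-elim (present λ w vw → none (w , vw))

    neighbour-missing : ∀ {a v} → Missing c v a → neighbour c a v ≡ v
    neighbour-missing {a} {v} missing with any? (hasColour? c v a)
    ... | yes (w , vw) = ⊥-elim (missing w vw)
    ... | no  _        = refl

    neighbour-involutive : ∀ a v → neighbour c a (neighbour c a v) ≡ v
    neighbour-involutive a v with missing? c v a
    ... | no  present = neighbour-unique (trans (comm _ v) (neighbour-coloured present))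
    ... | yes missing = trans (cong (neighbour c a) (neighbour-missing missing)) (neighbour-missing missing)

  -- Kempe chains

  -- The involutions send a vertex along its `α` or `β` edge. As `α` is missing at `x`, the first
  -- fixes `x`, so the component of `x` is a path ending there; `end-unique` then speaks of vertices
  -- missing `β`.
  module Kempe {E : EdgeSet n} {c : Colouring} (ok : IsColouring E c)
               {α β : Fin k} {x : Fin n} (α-missing : Missing c x α) where
    open IsColouring ok
    open AlternatingPath (alternatingPath {f = neighbour c α} {g = neighbour c β}
      (neighbour-involutive ok α) (neighbour-involutive ok β) (neighbour-missing ok α-missing)) public

    swap : Fin k → Fin k
    swap = transpose α β

    -- Testing one endpoint suffices, since edges leaving the component carry neither of the two
    -- colours.
    swapped : Colouring
    swapped u v = if does (inside? u) then Maybe.map swap (c u v) else c u v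

    swapped-inside : ∀ {u} v → Inside u → swapped u v ≡ Maybe.map swap (c u v)
    swapped-inside {u} v u∈ rewrite dec-true (inside? u) u∈ = refl

    swapped-outside : ∀ {u} v → ¬ Inside u → swapped u v ≡ c u v
    swapped-outside {u} v u∉ rewrite dec-false (inside? u) u∉ = refl

    -- An `α` or `β` edge from `u` ends inside, by `closed-f` and `closed-g`.
    leaves-component : ∀ {u v} → Inside u → ¬ Inside v → Maybe.map swap (c u v) ≡ c u v
    leaves-component {u} {v} u∈ v∉ with c u v in uv
    ... | nothing = refl
    ... | just a  = cong just (transpose-fixes
      (λ { refl → v∉ (subst Inside (neighbour-unique ok uv) (closed-f u∈)) })
      (λ { refl → v∉ (subst Inside (neighbour-unique ok uv) (closed-g u∈)) }))

    swapped-comm : ∀ u v → swapped u v ≡ swapped v u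
    swapped-comm u v = go (inside? u) (inside? v)
      where
      go : Dec (Inside u) → Dec (Inside v) → swapped u v ≡ swapped v u
      go (yes u∈) (yes v∈) = trans (swapped-inside v u∈)
        (trans (cong (Maybe.map swap) (comm u v)) (sym (swapped-inside u v∈)))
      go (yes u∈) (no  v∉) = trans (swapped-inside v u∈)
        (trans (leaves-component u∈ v∉) (trans (comm u v) (sym (swapped-outside u v∉))))
      go (no  u∉) (yes v∈) = trans (swapped-outside v u∉)
        (trans (comm u v) (trans (sym (leaves-component v∈ u∉)) (sym (swapped-inside u v∈))))
      go (no  u∉) (no  v∉) = trans (swapped-outside v u∉) (trans (comm u v) (sym (swapped-outside u v∉)))

    swap-injective : ∀ {r s} → Maybe.map swap r ≡ Maybe.map swap s → r ≡ s
    swap-injective = map-injective (transpose-injective α β)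

    swapped-⊒ : c ⊑ swapped
    swapped-⊒ {u} {v} (a , uv) with does (inside? u)
    ... | true  = swap a , cong (Maybe.map swap) uv
    ... | false = a , uv

    swapped-⊑ : swapped ⊑ c
    swapped-⊑ {u} {v} (a , uv) with does (inside? u) | c u v
    ... | true  | just b = b , refl
    ... | false | just b = b , refl

    swapped-ok : IsColouring E swapped
    swapped-ok = record
      { sub    = λ uv → sub (proj₂ (swapped-⊑ (_ , uv)))
      ; comm   = swapped-comm
      ; proper = λ {u} {v} {w} {a} → swapped-proper u v w a
      }
      where
      swapped-proper : ∀ u v w a → swapped u v ≡ just a → swapped u w ≡ just a → v ≡ w
      swapped-proper u v w a uv uw with does (inside? u)
      ... | false = proper uv uw
      ... | true with c u v in uv′
      ...   | just b = proper uv′ (swap-injective (trans uw (sym uv)))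

    swapped-missing-inside : ∀ {u a} → Inside u → Missing c u a → Missing swapped u (swap a)
    swapped-missing-inside u∈ missing w uw =
      missing w (swap-injective (trans (sym (swapped-inside w u∈)) uw))

    swapped-missing-outside : ∀ {u a} → ¬ Inside u → Missing c u a → Missing swapped u a
    swapped-missing-outside u∉ missing w uw = missing w (trans (sym (swapped-outside w u∉)) uw)

    -- The purpose of the exchange: the free colour `α` of `x` turns into `β`.
    β-missing : Missing swapped x β
    β-missing = subst (Missing swapped x) (transpose-left α β) (swapped-missing-inside start α-missing)

  -- Recolouring a single edge

  SamePair : (x y u v : Fin n) → Set
  SamePair x y u v = (u ≡ x × v ≡ y) ⊎ (u ≡ y × v ≡ x)

  samePair? : ∀ x y u v → Dec (SamePair x y u v)
  samePair? x y u v = ((u ≟ x) ×-dec (v ≟ y)) ⊎-dec ((u ≟ y) ×-dec (v ≟ x))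

  samePair-swap : ∀ {x y u v} → SamePair x y u v → SamePair x y v u
  samePair-swap (inj₁ (p , q)) = inj₂ (q , p)
  samePair-swap (inj₂ (p , q)) = inj₁ (q , p)

  update : Colouring → Fin n → Fin n → Maybe (Fin k) → Colouring
  update c x y r u v = if does (samePair? x y u v) then r else c u v

  module _ {c : Colouring} {x y : Fin n} {r : Maybe (Fin k)} where

    update-hit : ∀ {u v} → SamePair x y u v → update c x y r u v ≡ r
    update-hit {u} {v} same rewrite dec-true (samePair? x y u v) same = refl

    update-miss : ∀ {u v} → ¬ SamePair x y u v → update c x y r u v ≡ c u v
    update-miss {u} {v} other rewrite dec-false (samePair? x y u v) other = refl

    update-cases : ∀ u v → SamePair x y u v × update c x y r u v ≡ r
                         ⊎ ¬ SamePair x y u v × update c x y r u v ≡ c u v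
    update-cases u v with samePair? x y u v
    ... | yes same  = inj₁ (same , update-hit same)
    ... | no  other = inj₂ (other , update-miss other)

    update-comm : (∀ u v → c u v ≡ c v u) → ∀ u v → update c x y r u v ≡ update c x y r v u
    update-comm comm u v with update-cases u v
    ... | inj₁ (same , eq)  = trans eq (sym (update-hit (samePair-swap same)))
    ... | inj₂ (other , eq) = trans eq (trans (comm u v) (sym (update-miss (other ∘ samePair-swap))))

  insert : ∀ {E : EdgeSet n} {c x y a} → IsColouring E c → Joins E x y →
           Missing c x a → Missing c y a → IsColouring E (update c x y (just a))
  insert {E} {c} {x} {y} {a} ok xy x-missing y-missing = record
    { sub    = λ {u} {v} → sub′ u v
    ; comm   = update-comm {c} comm
    ; proper = λ {u} {v} {w} → proper′ u v w
    }
    where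
    open IsColouring ok

    sub′ : ∀ u v {b} → update c x y (just a) u v ≡ just b → Joins E u v
    sub′ u v uv with update-cases {c} {x} {y} {just a} u v
    ... | inj₁ (inj₁ (refl , refl) , _) = xy
    ... | inj₁ (inj₂ (refl , refl) , _) = joins-sym {E} xy
    ... | inj₂ (_ , eq)                 = sub (trans (sym eq) uv)

    missing-at : ∀ {u v} → SamePair x y u v → Missing c u a
    missing-at (inj₁ (refl , _)) = x-missing
    missing-at (inj₂ (refl , _)) = y-missing

    same-end : ∀ {u v w} → SamePair x y u v → SamePair x y u w → v ≡ w
    same-end (inj₁ (_ , refl))    (inj₁ (_ , refl))    = refl
    same-end (inj₁ (refl , refl)) (inj₂ (refl , refl)) = refl
    same-end (inj₂ (refl , refl)) (inj₁ (refl , refl)) = refl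
    same-end (inj₂ (_ , refl))    (inj₂ (_ , refl))    = refl

    clash : ∀ {u v w b} → SamePair x y u v → update c x y (just a) u v ≡ just b → c u w ≢ just b
    clash same uv uw = missing-at same _
      (trans uw (trans (sym uv) (update-hit {c} same)))

    proper′ : ∀ u v w {b} → update c x y (just a) u v ≡ just b →
              update c x y (just a) u w ≡ just b → v ≡ w
    proper′ u v w uv uw with update-cases {c} {x} {y} {just a} u v | update-cases {c} {x} {y} {just a} u w
    ... | inj₁ (same , _) | inj₁ (same′ , _) = same-end same same′
    ... | inj₁ (same , _) | inj₂ (_ , eq)    = ⊥-elim (clash same uv (trans (sym eq) uw))
    ... | inj₂ (_ , eq)   | inj₁ (same , _)  = ⊥-elim (clash same uw (trans (sym eq) uv))
    ... | inj₂ (_ , eq)   | inj₂ (_ , eq′)   = proper (trans (sym eq) uv) (trans (sym eq′) uw)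

  remove-⊆ : ∀ {c : Colouring} {x y u v a} → update c x y nothing u v ≡ just a →
             ¬ SamePair x y u v × c u v ≡ just a
  remove-⊆ {c} {x} {y} {u} {v} uv with update-cases {c} {x} {y} {nothing} u v
  ... | inj₁ (_ , eq) with () ← trans (sym eq) uv
  ... | inj₂ (other , eq) = other , trans (sym eq) uv

  remove : ∀ {E : EdgeSet n} {c x y} → IsColouring E c → IsColouring E (update c x y nothing)
  remove {E} {c} {x} {y} ok = record
    { sub    = sub ∘ kept
    ; comm   = update-comm {c} comm
    ; proper = λ uv uw → proper (kept uv) (kept uw)
    }
    where
    open IsColouring ok
    kept : ∀ {u v a} → update c x y nothing u v ≡ just a → c u v ≡ just a
    kept {u} {v} = proj₂ ∘ remove-⊆ {c} {x} {y} {u} {v}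

  -- Vizing fans

  -- Only the first m + 1 values of f matter.
  record Fan (E : EdgeSet n) (c : Colouring) (x : Fin n) (f : ℕ → Fin n) (m : ℕ) : Set where
    field
      colouring  : IsColouring E c
      joins      : Joins E x (f 0)
      uncoloured : c x (f 0) ≡ nothing
      distinct   : ∀ {i j} → i ≤ m → j ≤ m → f i ≡ f j → i ≡ j
      steps      : ∀ {i} → i < m → ∃[ a ] c x (f (suc i)) ≡ just a × Missing c (f i) a

    joins-all : ∀ {i} → i ≤ m → Joins E x (f i)
    joins-all {zero}  _   = joins
    joins-all {suc i} i<m = IsColouring.sub colouring (proj₁ (proj₂ (steps i<m)))

  -- Moves the colour of the edge to `f 1` onto the edge to `f 0`. The uncoloured edge advances one
  -- place, and a fan shorter by one vertex remains.
  module Shift {E : EdgeSet n} {c : Colouring} {x : Fin n} {f : ℕ → Fin n} {m : ℕ}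
               (fan : Fan E c x f (suc m)) where
    open Fan fan
    open IsColouring colouring

    private
      step₀ : ∃[ a ] c x (f 1) ≡ just a × Missing c (f 0) a
      step₀ = steps (s≤s z≤n)

      a₀ : Fin k
      a₀ = proj₁ step₀

      removed : Colouring
      removed = update c x (f 1) nothing

      x≢f : ∀ {i} → i ≤ suc m → x ≢ f i
      x≢f i≤ = distinct-ends {E} (joins-all i≤)

    shifted : Colouring
    shifted = update removed x (f 0) (just a₀)

    shifted-ok : IsColouring E shifted
    shifted-ok = insert (remove colouring) joins
      -- By properness the only `a₀` edge at `x` led to `f 1`, and that edge has just lost its
      -- colour.
      (λ w xw → let other , xw′ = remove-⊆ {c} {x} {f 1} {x} {w} xw
                in other (inj₁ (refl , proper xw′ (proj₁ (proj₂ step₀)))))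
      (λ w fw → proj₂ (proj₂ step₀) w (proj₂ (remove-⊆ {c} {x} {f 1} {f 0} {w} fw)))

    shifted-first : shifted x (f 0) ≡ just a₀
    shifted-first = update-hit {removed} {x} {f 0} (inj₁ (refl , refl))

    private
      not-first : ∀ {i} → i ≤ m → ∀ {w} → ¬ SamePair x (f 0) (f (suc i)) w
      not-first i≤m (inj₁ (eq , _)) = x≢f (s≤s i≤m) (sym eq)
      not-first i≤m (inj₂ (eq , _)) with () ← distinct (s≤s i≤m) z≤n eq

      away : ∀ {i j} → i ≤ suc m → j ≤ suc m → i ≢ j → ¬ SamePair x (f j) x (f i)
      away i≤ j≤ i≢j (inj₁ (_ , eq)) = i≢j (distinct i≤ j≤ eq)
      away i≤ j≤ i≢j (inj₂ (_ , eq)) = x≢f i≤ (sym eq)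

    shifted-second : shifted x (f 1) ≡ nothing
    shifted-second = trans (update-miss {removed} (away (s≤s z≤n) z≤n λ ()))
                           (update-hit {c} (inj₁ (refl , refl)))

    -- The insertion touches only `x` and `f 0`, and the removal can only free colours.
    shifted-missing : ∀ {i a} → i ≤ m → Missing c (f (suc i)) a → Missing shifted (f (suc i)) a
    shifted-missing {i} i≤m missing w fw = missing w (proj₂ (remove-⊆ {c} {x} {f 1} {f (suc i)} {w}
      (trans (sym (update-miss {removed} (not-first i≤m))) fw)))

    -- At `x` the colour `a₀` merely changes edges; it was present before, so a missing colour
    -- differs from it.
    shifted-missing-centre : ∀ {a} → Missing c x a → Missing shifted x a
    shifted-missing-centre missing w xw with update-cases {removed} {x} {f 0} {just a₀} x w
    ... | inj₁ (_ , eq) = missing (f 1) (trans (proj₁ (proj₂ step₀)) (trans (sym eq) xw))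
    ... | inj₂ (_ , eq) = missing w (proj₂ (remove-⊆ {c} {x} {f 1} {x} {w} (trans (sym eq) xw)))

    shifted-fan : Fan E shifted x (f ∘ suc) m
    shifted-fan = record
      { colouring  = shifted-ok
      ; joins      = joins-all (s≤s z≤n)
      ; uncoloured = shifted-second
      ; distinct   = λ i≤m j≤m eq → ℕ.suc-injective (distinct (s≤s i≤m) (s≤s j≤m) eq)
      ; steps      = λ i<m → let a , xf , missing = steps (s≤s i<m) in
          a , trans (update-miss {removed} (away (s≤s i<m) z≤n λ ()))
                (trans (update-miss {c} (away (s≤s i<m) (s≤s z≤n) λ ())) xf)
            , shifted-missing (ℕ.<⇒≤ i<m) missing
      }

    -- `c ⊑ shifted` fails at the edge to `f 1`, but the given completion colours exactly that edge
    -- again.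
    unshift : Completion E shifted x (f 1) → Completion E c x (f 0)
    unshift (c′ , ok′ , ⊑′ , xf₁) = c′ , ok′ , (λ {u} {v} → extends u v) , ⊑′ (a₀ , shifted-first)
      where
      extends : ∀ u v → Coloured c u v → Coloured c′ u v
      extends u v (a , uv) with update-cases {c} {x} {f 1} {nothing} u v
      ... | inj₁ (inj₁ (refl , refl) , _) = xf₁
      ... | inj₁ (inj₂ (refl , refl) , _) = proj₁ xf₁ , trans (IsColouring.comm ok′ u v) (proj₂ xf₁)
      ... | inj₂ (_ , eq) with update-cases {removed} {x} {f 0} {just a₀} u v
      ...   | inj₁ (_ , eq′) = ⊑′ (a₀ , eq′)
      ...   | inj₂ (_ , eq′) = ⊑′ (a , trans eq′ (trans eq uv))

  -- Each shift keeps `a` missing at the centre and at the last vertex. Once the fan has a single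
  -- vertex, its uncoloured edge can take `a`.
  rotate : ∀ {E c x f} m → Fan E c x f m → ∀ {a} → Missing c x a → Missing c (f m) a → Completion E c x (f 0)
  rotate {c = c} {x} {f} zero fan {a} x-missing y-missing =
    update c x (f 0) (just a) , insert colouring joins x-missing y-missing ,
    (λ {u} {v} → extends u v) , a , update-hit {c} (inj₁ (refl , refl))
    where
    open Fan fan
    extends : ∀ u v → Coloured c u v → Coloured (update c x (f 0) (just a)) u v
    extends u v (b , uv) with update-cases {c} {x} {f 0} {just a} u v
    ... | inj₁ (_ , eq) = a , eq
    ... | inj₂ (_ , eq) = b , trans eq uv
  rotate (suc m) fan x-missing y-missing =
    unshift (rotate m shifted-fan (shifted-missing-centre x-missing) (shifted-missing ℕ.≤-refl y-missing))
    where open Shift fan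

  -- Extending a colouring edge by edge

  module _ {E : EdgeSet n} (free : ∀ {c} → IsColouring E c → ∀ v → ∃ (Missing c v)) where

    extend : ∀ {c x y} → IsColouring E c → Joins E x y → c x y ≡ nothing → Completion E c x y
    extend {c} {x} {y} ok xy xy-uncoloured = finish (proj₁ (proj₂ stops))
      where
      open IsColouring ok

      m : Fin n → Fin k
      m v = proj₁ (free ok v)

      m-missing : ∀ v → Missing c v (m v)
      m-missing v = proj₂ (free ok v)

      f : ℕ → Fin n
      -- If the chosen colour is missing at `x`, `neighbour` defaults to `x`; the fan stops before
      -- that value.
      f = fold y λ v → neighbour c (m v) x

      Repeats : ℕ → Set
      Repeats t = ∃ λ (i : Fin (suc t)) → f (suc t) ≡ f (toℕ i)

      Stop : ℕ → Set
      Stop t = Missing c x (m (f t)) ⊎ Repeats t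

      stop? : Decidable Stop
      stop? t = missing? c x (m (f t)) ⊎-dec any? λ i → f (suc t) ≟ f (toℕ i)

      repeats : ∀ {i t} → i ≤ t → f i ≡ f (suc t) → Repeats t
      repeats i≤t eq = fromℕ< (s≤s i≤t) , trans (sym eq) (cong f (sym (toℕ-fromℕ< (s≤s i≤t))))

      eventually : ∃ Stop
      eventually with pigeonhole (ℕ.n<1+n n) (f ∘ toℕ)
      ... | i , suc j , s≤s i≤j , eq = toℕ j , inj₂ (repeats i≤j eq)

      abstract
        stops : ∃ (IsMinimum Stop)
        stops = minimum stop? (proj₁ eventually) (proj₂ eventually)

      t : ℕ
      t = proj₁ stops

      continues : ∀ {s} → s < t → ¬ Stop s
      continues s<t stop = ℕ.<⇒≱ s<t (proj₂ (proj₂ stops) _ stop)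

      step-colour : ∀ s → ¬ Missing c x (m (f s)) → c x (f (suc s)) ≡ just (m (f s))
      step-colour _ = neighbour-coloured ok

      step : ∀ {s} → s < t → c x (f (suc s)) ≡ just (m (f s))
      step {s} s<t = step-colour s (continues s<t ∘ inj₁)

      -- Minimality of `t` rules out a repeat among `f 0`, ..., `f t`.
      f-≢ : ∀ {i j} → i < j → j ≤ t → f i ≢ f j
      f-≢ {j = suc j} (s≤s i≤j) j<t eq = continues j<t (inj₂ (repeats i≤j eq))

      f-injective : ∀ {i j} → i ≤ t → j ≤ t → f i ≡ f j → i ≡ j
      f-injective {i} {j} i≤t j≤t eq with ℕ.<-cmp i j
      ... | tri< i<j _ _ = ⊥-elim (f-≢ i<j j≤t eq)
      ... | tri≈ _ i≡j _ = i≡j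
      ... | tri> _ _ j<i = ⊥-elim (f-≢ j<i i≤t (sym eq))

      fan : Fan E c x f t
      fan = record
        { colouring = ok ; joins = xy ; uncoloured = xy-uncoloured ; distinct = f-injective
        ; steps = λ {s} s<t → m (f s) , step s<t , m-missing (f s) }

      -- The `β` edge at `x` is the fan edge to `f (suc l)`, so `β` is missing at both `f l` and
      -- `f t`. The exchange frees `β` at `x`, and the fan is then rotated up to whichever of the
      -- two lies outside the component.
      module Closing {l : ℕ} (l<t : l < t) (present : ¬ Missing c x (m (f t)))
                     (closes : f (suc t) ≡ f (suc l)) where
        α β : Fin k
        α = m x
        β = m (f t)

        open Kempe ok {α} {β} (m-missing x)

        β-edge : c x (f (suc l)) ≡ just β
        β-edge = subst (λ v → c x v ≡ just β) closes (step-colour t present)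

        ml≡β : m (f l) ≡ β
        ml≡β = just-injective (trans (sym (step l<t)) β-edge)

        l-missing : Missing c (f l) β
        l-missing = subst (Missing c (f l)) ml≡β (m-missing (f l))

        -- By properness at `x`, distinct fan edges have distinct colours.
        only-l : ∀ {s} → s < t → m (f s) ≡ β → s ≡ l
        only-l s<t eq = ℕ.suc-injective (f-injective s<t l<t
          (proper (trans (step s<t) (cong just eq)) β-edge))

        swap-fixes : ∀ {s} → s < t → s ≢ l → swap (m (f s)) ≡ m (f s)
        swap-fixes s<t s≢l = transpose-fixes
          -- The colour `m (f s)` occurs at `x`, where `α` is missing.
          (λ eq → m-missing x _ (trans (step s<t) (cong just eq)))
          (s≢l ∘ only-l s<t)

        -- All fan edges meet `x`, so their colours are exchanged. The new colour stays missing at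
        -- `f s` if `f s` is inside, or if the exchange fixes it, which holds for `s ≢ l`. The
        -- remaining case is `f l` outside; the last hypothesis excludes it whenever the fan goes
        -- past `f l`.
        swapped-fan : ∀ t′ → t′ ≤ t → (l < t′ → Inside (f l)) → Fan E swapped x f t′
        swapped-fan t′ t′≤t l-inside = record
          { colouring  = swapped-ok
          ; joins      = xy
          ; uncoloured = trans (swapped-inside y start) (cong (Maybe.map swap) xy-uncoloured)
          ; distinct   = λ i≤ j≤ → f-injective (ℕ.≤-trans i≤ t′≤t) (ℕ.≤-trans j≤ t′≤t)
          ; steps      = λ {s} s<t′ → swap (m (f s))
              , trans (swapped-inside _ start) (cong (Maybe.map swap) (step (ℕ.≤-trans s<t′ t′≤t)))
              , step-missing s s<t′
          }
          where
          step-missing : ∀ s → s < t′ → Missing swapped (f s) (swap (m (f s)))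
          step-missing s s<t′ = go (inside? (f s))
            where
            go : Dec (Inside (f s)) → Missing swapped (f s) (swap (m (f s)))
            go (yes s∈) = swapped-missing-inside s∈ (m-missing (f s))
            go (no  s∉) = subst (Missing swapped (f s))
              (sym (swap-fixes (ℕ.≤-trans s<t′ t′≤t) λ { refl → s∉ (l-inside s<t′) }))
              (swapped-missing-outside s∉ (m-missing (f s)))

        unswap : Completion E swapped x y → Completion E c x y
        unswap (c′ , ok′ , ⊑′ , xy′) = c′ , ok′ , ⊑′ ∘ swapped-⊒ , xy′

        -- f l and f t both end a β-missing chain, so at most one of them lies
        -- in the component of x.
        complete : Completion E c x y
        complete with inside? (f l)
        -- The fan is cut at `f l`, which makes the condition on `f l` vacuous.
        ... | no  l∉ = unswap (rotate l (swapped-fan l (ℕ.<⇒≤ l<t) (⊥-elim ∘ ℕ.<-irrefl refl))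
                                β-missing (swapped-missing-outside l∉ l-missing))
        ... | yes l∈ = unswap (rotate t (swapped-fan t ℕ.≤-refl (λ _ → l∈))
                                β-missing (swapped-missing-outside t∉ (m-missing (f t))))
          where
          t∉ : ¬ Inside (f t)
          t∉ t∈ = f-≢ l<t ℕ.≤-refl (end-unique l∈ t∈
            (neighbour-missing ok l-missing) (neighbour-missing ok (m-missing (f t))))

      finish : Stop t → Completion E c x y
      -- Decided again because a repeat counts as closing only if `m (f t)` is present at `x`.
      finish stop with missing? c x (m (f t))
      finish _           | yes missing = rotate t fan missing (m-missing (f t))
      finish (inj₁ miss) | no  present = ⊥-elim (present miss)
      -- Returning to `f 0` is impossible: the edge `x y` is uncoloured, whereas the edge to
      -- `f (suc t)` has a colour.
      finish (inj₂ (zero , closes))  | no present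
        with () ← trans (sym xy-uncoloured) (trans (cong (c x) (sym closes)) (step-colour t present))
      finish (inj₂ (suc l , closes)) | no present = Closing.complete (toℕ<n l) present closes

    colour-pairs : ∀ (ps : List (Fin n × Fin n)) → ∃ λ c → IsColouring E c ×
      (∀ {u v} → (u , v) List.∈ ps → Joins E u v → Coloured c u v)
    colour-pairs [] = (λ _ _ → nothing) ,
      record { sub = λ () ; comm = λ _ _ → refl ; proper = λ () } , λ ()
    colour-pairs ((u , v) ∷ ps) with colour-pairs ps
    ... | c , ok , done with T? (member E u v) | c u v in uv
    ...   | no ¬e | _ = c , ok , λ { (here refl) e → ⊥-elim (¬e e) ; (there p) → done p }
    -- This happens, for instance, when the reversed pair was treated earlier.
    ...   | yes _ | just a = c , ok , λ { (here refl) _ → a , uv ; (there p) → done p }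
    ...   | yes e | nothing with extend ok e uv
    ...     | c′ , ok′ , ⊑′ , uv′ = c′ , ok′ ,
      λ { (here refl) _ → uv′ ; (there p) e′ → ⊑′ (done p e′) }

    colour-all : ∃ λ c → IsColouring E c × (∀ {u v} → Joins E u v → Coloured c u v)
    colour-all with colour-pairs (cartesianProduct (allFin n) (allFin n))
    ... | c , ok , done = c , ok , done (∈-cartesianProduct⁺ (∈-allFin _) (∈-allFin _))

-- Colour classes

injection⇒≤∣∣ : ∀ {n k} (p : Subset n) (f : Fin k → Fin n) → (∀ i → f i ∈ p) →
                (∀ {i j} → f i ≡ f j → i ≡ j) → k ≤ ∣ p ∣
injection⇒≤∣∣ {k = zero}  p f f∈ inj = z≤n
injection⇒≤∣∣ {k = suc k} p f f∈ inj = ℕ.≤-<-trans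
  (injection⇒≤∣∣ (p - f zero) (f ∘ suc)
    (λ i → x∈p∧x≢y⇒x∈p-y (f∈ (suc i)) λ eq → case inj eq of λ ())
    (suc-injective ∘ inj))
  (x∈p⇒∣p-x∣<∣p∣ (f∈ zero))

-- Vertices of `⟨ F ⟩` are endpoints, so each has a neighbour and hence exactly one: a matching is
-- 1-regular.
unique-neighbour⇒regular : ∀ {n} (F : EdgeSet n) →
  (∀ {u v w} → Joins F u v → Joins F u w → v ≡ w) → Regular ⟨ F ⟩
unique-neighbour⇒regular F unique = 1 , λ u u∈ →
  let v , uv = Equivalence.to (∈-endpoints F u) u∈ in
  trans (cong ∣_∣ (⊆-antisym
      (λ {w} w∈ → subst (_∈ ⁅ v ⁆) (unique uv (Equivalence.to (∈-neighbours F u w) w∈)) (x∈⁅x⁆ v))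
      (λ {w} w∈ → subst (_∈ neighbours F u) (sym (x∈⁅y⁆⇒x≡y v w∈)) (Equivalence.from (∈-neighbours F u v) uv))))
    (∣⁅x⁆∣≡1 v)

degree≤maxDegree : ∀ {n} (G : Graph n) {v} → v ∈ vertices G → degree G v ≤ maxDegree G
degree≤maxDegree G v∈ = All.lookup (xs≤max 0 _)
  (∈-map⁺ (degree G) (∈-filter⁺ (_∈? vertices G) (∈-allFin _) v∈))

-- If every colour occurred at `v`, properness would give `v` at least Δ + 1 different neighbours.
free-colour : ∀ {n} (G : Graph n) {c : Colouring {n} {suc (maxDegree G)}} →
  IsColouring (edges G) c → ∀ v → ∃ (Missing c v)
free-colour {n} G {c} ok v with any? (missing? c v)
... | yes free = free
-- The edge of colour `zero` shows that `v` is a vertex of `G`, as the degree bound requires.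
... | no  none = ⊥-elim (ℕ.<⇒≱ too-many (degree≤maxDegree G (incident G (edge zero))))
  where
  open IsColouring ok

  w : Fin (suc (maxDegree G)) → Fin n
  w a = neighbour c a v

  coloured : ∀ a → c v (w a) ≡ just a
  coloured a = neighbour-coloured ok λ missing → none (a , missing)

  edge : ∀ a → Joins (edges G) v (w a)
  edge a = sub (coloured a)

  too-many : maxDegree G < degree G v
  too-many = injection⇒≤∣∣ (neighbours (edges G) v) w
    (λ a → Equivalence.from (∈-neighbours (edges G) v (w a)) (edge a))
    (λ {a} {b} eq → just-injective (trans (sym (coloured a)) (trans (cong (c v) eq) (coloured b))))

-- Parts must be nonempty, so only the colours that occur are kept; hence `j ≤ k` rather than
-- equality.
colouring⇒partition : ∀ {n k} (G : Graph n) {c : Colouring {n} {k}} → IsColouring (edges G) c →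
  (∀ {u v} → Joins (edges G) u v → Coloured c u v) → ∃ λ j → j ≤ k × HasRegularPartition G j
colouring⇒partition {n} {k} G {c} ok total =
  length used , subst (length used ≤_) (length-tabulate id) (length-filter used? (allFin k)) ,
  class ∘ lookup used ,
  record { nonempty = nonempty ; sub = λ i u v → sub ∘ to ; cover = cover ; disjoint = disjoint } ,
  λ i → unique-neighbour⇒regular (class (lookup used i)) (λ uv uw → proper (to uv) (to uw))
  where
  open IsColouring ok

  Used : Fin k → Set
  Used a = ∃ λ u → ∃ λ v → c u v ≡ just a

  used? : Decidable Used
  used? a = any? λ u → any? (hasColour? c u a)

  used : List (Fin k)
  used = filter used? (allFin k)

  class : Fin k → EdgeSet n
  class a = record
    { member      = λ u v → does (hasColour? c u a v)
    ; symmetric   = λ u v → cong (λ r → does (≡-dec _≟_ r (just a))) (comm u v)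
    ; irreflexive = λ v → dec-false (hasColour? c v a v)
        λ vv → distinct-ends {k = k} {E = edges G} (sub vv) refl
    }

  to : ∀ {a u v} → Joins (class a) u v → c u v ≡ just a
  to {a} {u} {v} = Equivalence.to (T-does (hasColour? c u a v))

  from : ∀ {a u v} → c u v ≡ just a → Joins (class a) u v
  from {a} {u} {v} = Equivalence.from (T-does (hasColour? c u a v))

  nonempty : ∀ i → HasEdge (class (lookup used i))
  nonempty i with ∈-filter⁻ used? {xs = allFin k} (∈-lookup i)
  ... | _ , u , v , uv = u , v , from uv

  cover : ∀ u v → Joins (edges G) u v → ∃[ i ] Joins (class (lookup used i)) u v
  cover u v e = index a∈ , from (trans uv (cong just (lookup-index a∈)))
    where
    uv = proj₂ (total e)
    a∈ : proj₁ (total e) List.∈ used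
    a∈ = ∈-filter⁺ used? (∈-allFin _) (u , v , uv)

  disjoint : ∀ i j u v → Joins (class (lookup used i)) u v → Joins (class (lookup used j)) u v → i ≡ j
  -- An edge has one colour, and `used` lists each colour at most once.
  disjoint i j u v uv∈i uv∈j = lookup-injective (Unique.filter⁺ used? (Unique.allFin⁺ k)) i j
    (just-injective (trans (sym (to uv∈i)) (to uv∈j)))

corollary7 : ∀ {n : ℕ} (G : Graph n) → HasEdge (edges G) →
    regularNumber G ≤ maxDegree G + 1
corollary7 G _ =
  let c , ok , total = colour-all (free-colour G)
      j , j≤ , partition = colouring⇒partition G ok total
  in subst (regularNumber G ≤_) (ℕ.+-comm 1 (maxDegree G))
       (ℕ.≤-trans (proj₂ (regularNumber-isMinimum G) j partition) j≤)
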